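{- Let $n\geq 3$, let $I_n=\{0,\ldots,n-1\}$, and let $L$ be the set of strings $u\in\{0,1\}^n$ such that the number of $1$'s in $u$ is either $1$ or $n$. The minimal simplicial complexes over $I_n$ generating $L$ are exactly the complexes whose maximal simplices are $I_n\setminus\{a\}$ and $I_n\setminus\{b\}$, for distinct $a,b\in I_n$.
   Context: All sets are finite (possibly empty). For $f:B^J\to A^I$ write $f_i(x)=f(x)_i$. For $i\in I$, the input window $\mathcal{W}_f(i)$ is the smallest set $W\subseteq J$ (it exists) such that for all $x,y\in B^J$, $x|_W=y|_W$ implies $f_i(x)=f_i(y)$. A simplicial complex (or complex) over $I$ is a collection of subsets of $I$ (its simplices) closed under taking subsets; the empty set is a simplex of every complex. The communication complex $K_f$ of $f$ is the complex over $I$ in which a non-empty $S\subseteq I$ is a simplex iff $\bigcap_{i\in S}\mathcal{W}_f(i)\neq\emptyset$. A complex $K$ over $I$ generates a language $L\subseteq A^I$ if there exist finite sets $B,J$ and a function $f:B^J\to A^I$ with image exactly $L$ and $K_f\subseteq K$. A complex generating $L$ is minimal if no complex strictly contained in it generates $L$. We write $\{0,1\}^n$ for $\{0,1\}^{I_n}$. -}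

module Defs where

open import Level using (Level; 0ℓ)
open import Data.Nat.Base using (ℕ; zero; suc)
open import Data.Fin.Base using (Fin)
open import Data.Fin.Patterns using (1F)
open import Data.Fin.Properties using (_≟_; any?; all?)
open import Data.Fin.Subset using (Subset; _∈_; _⊆_; _⊂_; _∩_; ⊤; Nonempty; Empty)
open import Data.Fin.Subset.Properties
  using (_∈?_; _⊆?_; nonempty?; anySubset?; ∈⊤; p∩q⊆p; p∩q⊆q; x∈p∩q⁺; x∈p∩q⁻)
open import Data.Fin.Subset.Induction using (⊂-wellFounded)
open import Data.Product.Base using (∃; ∃-syntax; Σ-syntax; _×_; _,_; proj₁; proj₂)
open import Data.Sum.Base using (_⊎_; inj₁; inj₂)
open import Data.Vec.Base using (Vec; []; _∷_; lookup; tabulate; count)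
open import Data.Vec.Properties using (lookup∘tabulate; tabulate-cong; tabulate∘lookup)
open import Function.Bundles using (_⇔_)
open import Induction.WellFounded using (Acc; acc)
open import Relation.Binary.PropositionalEquality using (_≡_; refl; sym; trans; cong)
open import Relation.Nullary.Decidable
  using (Dec; yes; no; ¬?; _×-dec_; _→-dec_; _⊎-dec_; map′; decidable-stable)
open import Relation.Nullary.Negation using (¬_; contradiction)
open import Relation.Unary using (Pred; Decidable)
import Relation.Unary as U

-- A finite set is represented as Fin k for some k (possibly 0), and the
-- function space A^I, with A = Fin a and I = Fin n, as Vec (Fin a) n.

private
  variable
    ℓ : Level
    a b j n : ℕ

------------------------------------------------------------------------
-- Input windows

Agree : Subset j → Vec (Fin b) j → Vec (Fin b) j → Set
Agree W x y = ∀ k → k ∈ W → lookup x k ≡ lookup y k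

Determines : (Vec (Fin b) j → Vec (Fin a) n) → Fin n → Subset j → Set
Determines f i W = ∀ x y → Agree W x y → lookup (f x) i ≡ lookup (f y) i

IsSmallest : Pred (Subset j) ℓ → Pred (Subset j) ℓ
IsSmallest P W = P W × (∀ W′ → P W′ → W ⊆ W′)

private
  allVec? : {P : Pred (Vec (Fin b) j) ℓ} → Decidable P → Dec (∀ x → P x)
  allVec? {j = zero} P? = map′ (λ p → λ { [] → p }) (λ p → p []) (P? [])
  allVec? {j = suc j} P? =
    map′ (λ p → λ { (c ∷ x) → p c x }) (λ p c x → p (c ∷ x))
         (all? λ c → allVec? λ x → P? (c ∷ x))

  agree? : (W : Subset j) (x y : Vec (Fin b) j) → Dec (Agree W x y)
  agree? W x y = all? λ k → (k ∈? W) →-dec (lookup x k ≟ lookup y k)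

  determines? : (f : Vec (Fin b) j → Vec (Fin a) n) (i : Fin n) →
                Decidable (Determines f i)
  determines? f i W = allVec? λ x → allVec? λ y →
    agree? W x y →-dec (lookup (f x) i ≟ lookup (f y) i)

  determines-⊤ : (f : Vec (Fin b) j → Vec (Fin a) n) (i : Fin n) →
                 Determines f i ⊤
  determines-⊤ f i x y x≈y = cong (λ v → lookup (f v) i)
    (trans (sym (tabulate∘lookup x))
      (trans (tabulate-cong (λ k → x≈y k ∈⊤)) (tabulate∘lookup y)))

  -- x and y agreeing on V ∩ W are compared through the z that equals x on V
  -- and y elsewhere.
  determines-∩ : (f : Vec (Fin b) j → Vec (Fin a) n) (i : Fin n) →
                 ∀ V W → Determines f i V → Determines f i W →
                 Determines f i (V ∩ W)
  determines-∩ f i V W dV dW x y x≈y = trans (dV x z x≈z) (dW z y z≈y)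
    where
    pick : ∀ {k} → Dec (k ∈ V) → Fin _
    pick {k} (yes _) = lookup x k
    pick {k} (no  _) = lookup y k

    z = tabulate λ k → pick (k ∈? V)

    x≈z : Agree V x z
    x≈z k k∈V = trans (eq (k ∈? V)) (sym (lookup∘tabulate _ k))
      where
      eq : (d : Dec (k ∈ V)) → lookup x k ≡ pick d
      eq (yes _)  = refl
      eq (no k∉V) = contradiction k∈V k∉V

    z≈y : Agree W z y
    z≈y k k∈W = trans (lookup∘tabulate _ k) (eq (k ∈? V))
      where
      eq : (d : Dec (k ∈ V)) → pick d ≡ lookup y k
      eq (yes k∈V) = x≈y k (x∈p∩q⁺ (k∈V , k∈W))
      eq (no _)    = refl

  smallest : {P : Pred (Subset j) ℓ} → Decidable P → P ⊤ →
             (∀ V W → P V → P W → P (V ∩ W)) → ∃ (IsSmallest P)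
  smallest {P = P} P? P⊤ P∩ = go ⊤ P⊤ (⊂-wellFounded ⊤)
    where
    go : ∀ V → P V → Acc _⊂_ V → ∃ (IsSmallest P)
    go V pV (acc rec) with anySubset? (λ W → P? W ×-dec ¬? (V ⊆? W))
    ... | no none = V , pV , λ W pW →
      decidable-stable (V ⊆? W) λ V⊈W → none (W , pW , V⊈W)
    ... | yes (W , pW , V⊈W) with any? (λ k → (k ∈? V) ×-dec ¬? (k ∈? W))
    ...   | yes (k , k∈V , k∉W) = go (V ∩ W) (P∩ V W pV pW)
      (rec (p∩q⊆p V W , k , k∈V , λ k∈V∩W → k∉W (proj₂ (x∈p∩q⁻ V W k∈V∩W))))
    ...   | no none = contradiction
      (λ {k} k∈V → decidable-stable (k ∈? W) λ k∉W → none (k , k∈V , k∉W)) V⊈W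

inputWindow-exists : (f : Vec (Fin b) j → Vec (Fin a) n) (i : Fin n) →
                     ∃ (IsSmallest (Determines f i))
inputWindow-exists f i =
  smallest (determines? f i) (determines-⊤ f i) (determines-∩ f i)

inputWindow : (Vec (Fin b) j → Vec (Fin a) n) → Fin n → Subset j
inputWindow f i = proj₁ (inputWindow-exists f i)

inputWindow-smallest : (f : Vec (Fin b) j → Vec (Fin a) n) (i : Fin n) →
                       IsSmallest (Determines f i) (inputWindow f i)
inputWindow-smallest f i = proj₂ (inputWindow-exists f i)

------------------------------------------------------------------------
-- Simplicial complexes over Fin n

-- A collection of subsets of a finite set is itself a finite set, hence the
-- decidability requirement.  No vertex is required to be a simplex.
record Complex (n : ℕ) : Set₁ where
  field
    Simplex     : Pred (Subset n) 0ℓ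
    simplex?    : Decidable Simplex
    down-closed : ∀ {S T} → S ⊆ T → Simplex T → Simplex S
    ∅-simplex   : ∀ {S} → Empty S → Simplex S

open Complex public

infix 4 _⊆ᶜ_ _⊂ᶜ_

_⊆ᶜ_ : Complex n → Complex n → Set
K ⊆ᶜ K′ = Simplex K U.⊆′ Simplex K′

_⊂ᶜ_ : Complex n → Complex n → Set
K ⊂ᶜ K′ = Simplex K U.⊂′ Simplex K′

IsMaximalSimplex : Complex n → Subset n → Set
IsMaximalSimplex K S = Simplex K S × (∀ T → Simplex K T → S ⊆ T → T ≡ S)

communicationComplex : (Vec (Fin b) j → Vec (Fin a) n) → Complex n
communicationComplex f = record
  { Simplex     = λ S → Empty S ⊎ ∃[ k ] (∀ i → i ∈ S → k ∈ inputWindow f i)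
  ; simplex?    = λ S → ¬? (nonempty? S) ⊎-dec
      any? λ k → all? λ i → (i ∈? S) →-dec (k ∈? inputWindow f i)
  ; down-closed = λ where
      S⊆T (inj₁ T-empty)  → inj₁ λ (i , i∈S) → T-empty (i , S⊆T i∈S)
      S⊆T (inj₂ (k , k∈W)) → inj₂ (k , λ i i∈S → k∈W i (S⊆T i∈S))
  ; ∅-simplex   = inj₁
  }

------------------------------------------------------------------------
-- Generation of languages

Generates : Complex n → Pred (Vec (Fin a) n) 0ℓ → Set
Generates {n} {a} K L =
  ∃[ b ] ∃[ j ] Σ[ f ∈ (Vec (Fin b) j → Vec (Fin a) n) ]
    (∀ u → L u ⇔ (∃[ x ] f x ≡ u)) × communicationComplex f ⊆ᶜ K

IsMinimalGenerating : Complex n → Pred (Vec (Fin a) n) 0ℓ → Set₁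
IsMinimalGenerating K L =
  Generates K L × (∀ K′ → K′ ⊂ᶜ K → ¬ Generates K′ L)

#1s : Vec (Fin 2) n → ℕ
#1s = count (_≟ 1F)

OneOrAllOnes : (n : ℕ) → Pred (Vec (Fin 2) n) 0ℓ
OneOrAllOnes n u = #1s u ≡ 1 ⊎ #1s u ≡ n

{-# OPTIONS --safe #-}

-- Along a path changing one input at a time from x with f x = 1ⁿ to z with
-- f z ≠ 1ⁿ, some step turns 1ⁿ into a word with a single 1, at m say, so the
-- changed input lies in every window except perhaps that of m.  A first path
-- yields a facet missing some a.  A second path, chosen to change only inputs in
-- the window of a and to end with value 0 at a, yields either a facet missing
-- some m ≠ a or an input lying in every window.
-- Conversely, two inputs x and y, unseen by a and b respectively, suffice:
-- y decides the bit of a, x decides the bit of b, and if both vanish then x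
-- chooses the position of the 1 among the other vertices.

module Submission where

open import Defs
open import Data.Bool.Base using (true; false; if_then_else_)
open import Data.Empty using (⊥-elim)
open import Data.Nat.Base using (ℕ; zero; suc; _≤_; s≤s)
open import Data.Nat.Properties using (suc-injective; 1+n≰n; ≤-reflexive; ≤-trans)
open import Data.Fin.Base using (Fin; zero; suc; punchIn; punchOut)
open import Data.Fin.Patterns using (0F; 1F)
open import Data.Fin.Properties
  using (_≟_; any?; punchInᵢ≢i; punchIn-injective; punchIn-punchOut)
open import Data.Fin.Subset using (Subset; ⊤; _-_; _∈_; _∉_; _⊆_; _⊃_)
open import Data.Fin.Subset.Properties
  using (_∈?_; _⊆?_; anySubset?; ⊆-antisym; ⊆-refl; ⊆-trans; ∈⊤; x∈p∧x≢y⇒x∈p-y)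
open import Data.Fin.Subset.Induction using (⊃-wellFounded)
open import Data.Product.Base using (∃-syntax; _×_; _,_; proj₁; proj₂)
open import Data.Sum.Base as Sum using (_⊎_; inj₁; inj₂; [_,_]′)
open import Data.Vec.Base
  using (Vec; []; _∷_; here; there; lookup; tabulate; replicate; _[_]≔_)
open import Data.Vec.Properties
  using (count≤n; ≡-dec; lookup∘tabulate; lookup-replicate; lookup∘update;
         lookup∘update′; []=⇒lookup; lookup⇒[]=)
open import Function.Base using (_∘_)
open import Function.Bundles using (_⇔_; mk⇔; Equivalence)
open import Induction.WellFounded using (Acc; acc)
open import Level using (Level)
open import Relation.Binary.PropositionalEquality
  using (_≡_; _≢_; refl; sym; trans; cong)
open import Relation.Nullary.Decidable
  using (Dec; yes; no; ¬?; _×-dec_; _⊎-dec_; decidable-stable)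
open import Relation.Nullary.Negation using (¬_; contradiction)
open import Relation.Unary using (Pred; Decidable)

open Equivalence using (to; from)

private
  variable
    ℓ : Level
    b j n : ℕ

-- Words with a single 1 and the word of all 1s.

ones : Vec (Fin 2) n
ones = replicate _ 1F

unit : Fin n → Vec (Fin 2) n
unit m = replicate _ 0F [ m ]≔ 1F

lookup-unit-≢ : {i m : Fin n} → i ≢ m → lookup (unit m) i ≡ 0F
lookup-unit-≢ {i = i} i≢m =
  trans (lookup∘update′ i≢m (replicate _ 0F) 1F) (lookup-replicate i 0F)

#1s-ones : ∀ n → #1s (ones {n}) ≡ n
#1s-ones zero    = refl
#1s-ones (suc n) = cong suc (#1s-ones n)

#1s-zeros : ∀ n → #1s (replicate n 0F) ≡ 0
#1s-zeros zero    = refl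
#1s-zeros (suc n) = #1s-zeros n

#1s-unit : (m : Fin n) → #1s (unit m) ≡ 1
#1s-unit {suc n} zero = cong suc (#1s-zeros n)
#1s-unit (suc m)      = #1s-unit m

#1s≡n⇒ones : (u : Vec (Fin 2) n) → #1s u ≡ n → u ≡ ones
#1s≡n⇒ones []       _ = refl
#1s≡n⇒ones (0F ∷ u) p =
  contradiction (≤-trans (≤-reflexive (sym p)) (count≤n (_≟ 1F) u)) 1+n≰n
#1s≡n⇒ones (1F ∷ u) p = cong (1F ∷_) (#1s≡n⇒ones u (suc-injective p))

#1s≡0⇒zeros : (u : Vec (Fin 2) n) → #1s u ≡ 0 → u ≡ replicate n 0F
#1s≡0⇒zeros []       _ = refl
#1s≡0⇒zeros (0F ∷ u) p = cong (0F ∷_) (#1s≡0⇒zeros u p)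
#1s≡0⇒zeros (1F ∷ u) ()

#1s≡1⇒unit : (u : Vec (Fin 2) n) → #1s u ≡ 1 → ∃[ m ] u ≡ unit m
#1s≡1⇒unit (0F ∷ u) p =
  let m , u≡unit = #1s≡1⇒unit u p in suc m , cong (0F ∷_) u≡unit
#1s≡1⇒unit (1F ∷ u) p = zero , cong (1F ∷_) (#1s≡0⇒zeros u (suc-injective p))

OneOrAllOnes⇒ : (u : Vec (Fin 2) n) → OneOrAllOnes n u →
                (∃[ m ] u ≡ unit m) ⊎ u ≡ ones
OneOrAllOnes⇒ u = Sum.map (#1s≡1⇒unit u) (#1s≡n⇒ones u)

-- Complements of a vertex and maximal simplices.

x∉p-x : (x : Fin n) (p : Subset n) → x ∉ p - x
x∉p-x zero    (_ ∷ p) ()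
x∉p-x (suc x) (_ ∷ p) (there x∈p-x) = x∉p-x x p x∈p-x

x∉p⇒p⊆⊤-x : {x : Fin n} {p : Subset n} → x ∉ p → p ⊆ ⊤ - x
x∉p⇒p⊆⊤-x x∉p y∈p = x∈p∧x≢y⇒x∈p-y ∈⊤ λ { refl → x∉p y∈p }

⊤-x⊈⊤-y : {x y : Fin n} → x ≢ y → ¬ (⊤ - x ⊆ ⊤ - y)
⊤-x⊈⊤-y {y = y} x≢y ⊆ = x∉p-x y ⊤ (⊆ (x∈p∧x≢y⇒x∈p-y ∈⊤ (x≢y ∘ sym)))

-- Here three vertices are needed. With `x` removed, `y` has index `punchOut x≢y`; a vertex avoiding
-- that index is then carried back past `x`.
third : (x y : Fin (suc (suc (suc n)))) → x ≢ y → ∃[ z ] (z ≢ x × z ≢ y)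
third x y x≢y = punchIn x z , punchInᵢ≢i x z , λ z≡y →
  punchInᵢ≢i (punchOut x≢y) 0F
    (punchIn-injective x _ _ (trans z≡y (sym (punchIn-punchOut x≢y))))
  where z = punchIn (punchOut x≢y) 0F

maximal-⊇ : (K : Complex n) (S : Subset n) → Simplex K S →
            ∃[ T ] (IsMaximalSimplex K T × S ⊆ T)
maximal-⊇ {n} K S S∈K = go S S∈K (⊃-wellFounded S)
  where
  go : ∀ S → Simplex K S → Acc _⊃_ S → ∃[ T ] (IsMaximalSimplex K T × S ⊆ T)
  go S S∈K (acc rec)
    with anySubset? (λ T → simplex? K T ×-dec (S ⊆? T) ×-dec ¬? (T ⊆? S))
  ... | no none = S , (S∈K , maximal) , ⊆-refl
    where
    maximal : ∀ T → Simplex K T → S ⊆ T → T ≡ S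
    maximal T T∈K S⊆T = ⊆-antisym
      (decidable-stable (T ⊆? S) λ T⊈S → none (T , T∈K , S⊆T , T⊈S)) S⊆T
  ... | yes (T , T∈K , S⊆T , T⊈S)
    -- Strict inclusion asks for an explicit vertex of `T` outside `S`, so that the induction on
    -- supersets can proceed.
    with any? (λ k → (k ∈? T) ×-dec ¬? (k ∈? S))
  ...   | yes (k , k∈T , k∉S) =
    let U , U-max , T⊆U = go T T∈K (rec (S⊆T , k , k∈T , k∉S))
    in U , U-max , ⊆-trans S⊆T T⊆U
  ...   | no none = contradiction
    (λ {k} k∈T → decidable-stable (k ∈? S) λ k∉S → none (k , k∈T , k∉S)) T⊈S

-- Complexes with two facets.

twoFacets : Fin n → Fin n → Complex n
twoFacets a b = record
  -- Missing `a` amounts to lying in `⊤ - a`, and likewise for `b`.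
  { Simplex     = λ S → a ∉ S ⊎ b ∉ S
  ; simplex?    = λ S → ¬? (a ∈? S) ⊎-dec ¬? (b ∈? S)
  ; down-closed = λ S⊆T → Sum.map (_∘ S⊆T) (_∘ S⊆T)
  ; ∅-simplex   = λ S-empty → inj₁ λ a∈S → S-empty (a , a∈S)
  }

twoFacets-⊆ᶜ : (K : Complex n) {a b : Fin n} →
               Simplex K (⊤ - a) → Simplex K (⊤ - b) → twoFacets a b ⊆ᶜ K
twoFacets-⊆ᶜ K a∈K b∈K S =
  [ (λ a∉S → down-closed K (x∉p⇒p⊆⊤-x a∉S) a∈K)
  , (λ b∉S → down-closed K (x∉p⇒p⊆⊤-x b∉S) b∈K) ]′

HasFacets : Complex n → Fin n → Fin n → Set
HasFacets K a b = ∀ S → IsMaximalSimplex K S ⇔ (S ≡ ⊤ - a ⊎ S ≡ ⊤ - b)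

-- Every simplex lies in a maximal one, so the facets fix the complex up to mutual inclusion.
facets⇒twoFacets : (K : Complex n) {a b : Fin n} → HasFacets K a b →
                   K ⊆ᶜ twoFacets a b × twoFacets a b ⊆ᶜ K
facets⇒twoFacets K {a} {b} facets = K⊆ ,
  twoFacets-⊆ᶜ K (proj₁ (from (facets _) (inj₁ refl)))
                 (proj₁ (from (facets _) (inj₂ refl)))
  where
  K⊆ : K ⊆ᶜ twoFacets a b
  K⊆ S S∈K with maximal-⊇ K S S∈K
  ... | T , T-max , S⊆T with to (facets T) T-max
  ...   | inj₁ refl = inj₁ (x∉p-x a ⊤ ∘ S⊆T)
  ...   | inj₂ refl = inj₂ (x∉p-x b ⊤ ∘ S⊆T)

-- For distinct `a` and `b` neither complement contains the other, so both are maximal.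
twoFacets⇒facets : (K : Complex n) {a b : Fin n} → a ≢ b →
                   K ⊆ᶜ twoFacets a b → twoFacets a b ⊆ᶜ K → HasFacets K a b
twoFacets⇒facets K {a} {b} a≢b K⊆ ⊆K S = mk⇔ maximal⇒ ⇒maximal
  where
  maximal⇒ : IsMaximalSimplex K S → S ≡ ⊤ - a ⊎ S ≡ ⊤ - b
  maximal⇒ (S∈K , S-max) = Sum.map
    (λ a∉S → sym (S-max _ (⊆K _ (inj₁ (x∉p-x a ⊤))) (x∉p⇒p⊆⊤-x a∉S)))
    (λ b∉S → sym (S-max _ (⊆K _ (inj₂ (x∉p-x b ⊤))) (x∉p⇒p⊆⊤-x b∉S)))
    (K⊆ S S∈K)

  ⇒maximal : S ≡ ⊤ - a ⊎ S ≡ ⊤ - b → IsMaximalSimplex K S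
  ⇒maximal (inj₁ refl) = ⊆K _ (inj₁ (x∉p-x a ⊤)) , λ T T∈K S⊆T →
    [ (λ a∉T → ⊆-antisym (x∉p⇒p⊆⊤-x a∉T) S⊆T)
    , (λ b∉T → ⊥-elim (⊤-x⊈⊤-y a≢b (⊆-trans S⊆T (x∉p⇒p⊆⊤-x b∉T))))
    ]′ (K⊆ T T∈K)
  ⇒maximal (inj₂ refl) = ⊆K _ (inj₂ (x∉p-x b ⊤)) , λ T T∈K S⊆T →
    [ (λ a∉T → ⊥-elim (⊤-x⊈⊤-y (a≢b ∘ sym) (⊆-trans S⊆T (x∉p⇒p⊆⊤-x a∉T))))
    , (λ b∉T → ⊆-antisym (x∉p⇒p⊆⊤-x b∉T) S⊆T)
    ]′ (K⊆ T T∈K)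

twoFacets-facets : {a b c : Fin n} → Simplex (twoFacets a b) (⊤ - c) →
                   c ≡ a ⊎ c ≡ b
twoFacets-facets {c = c} = Sum.map missing missing
  where
  missing : ∀ {x} → x ∉ ⊤ - c → c ≡ x
  missing {x} x∉ = decidable-stable (c ≟ x) λ c≢x →
    x∉ (x∈p∧x≢y⇒x∈p-y ∈⊤ (c≢x ∘ sym))

-- Both `⊤ - c` and `⊤ - d` miss `a` or `b`, so `c` and `d`, being distinct, are `a` and `b` in some
-- order.
twoFacets-unique : {a b c d : Fin n} → c ≢ d →
                   twoFacets c d ⊆ᶜ twoFacets a b → twoFacets a b ⊆ᶜ twoFacets c d
twoFacets-unique {a = a} {b} {c} {d} c≢d ⊆
  with twoFacets-facets {a = a} {b} (⊆ _ (inj₁ (x∉p-x c ⊤)))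
     | twoFacets-facets {a = a} {b} (⊆ _ (inj₂ (x∉p-x d ⊤)))
... | inj₁ refl | inj₁ refl = contradiction refl c≢d
... | inj₁ refl | inj₂ refl = λ _ S → S
... | inj₂ refl | inj₁ refl = λ _ → Sum.swap
... | inj₂ refl | inj₂ refl = contradiction refl c≢d

-- A generating function with two inputs.

module TwoInputs {n} {a b c : Fin n} (a≢b : a ≢ b) (c≢a : c ≢ a) (c≢b : c ≢ b) where

  -- The first input must not influence the bit at `a`, so when it names `a` the 1 is diverted to
  -- the spare vertex `c`.
  position : ∀ x → Dec (x ≡ a) → Fin n
  position x (yes _) = c
  position x (no _)  = x

  position-≢a : ∀ x d → position x d ≢ a
  position-≢a x (yes _)  = c≢a
  position-≢a x (no x≢a) = x≢a

  position-≢b : ∀ x d → x ≢ b → position x d ≢ b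
  position-≢b x (yes _) _   = c≢b
  position-≢b x (no _)  x≢b = x≢b

  word : ∀ {x y} → Dec (x ≡ b) → Dec (y ≡ a) → Vec (Fin 2) n
  word     (yes _) (yes _) = ones
  word     (yes _) (no _)  = unit b
  word     (no _)  (yes _) = unit a
  word {x} (no _)  (no _)  = unit (position x (x ≟ a))

  bit : {P : Set} → Dec P → Fin 2
  bit (yes _) = 1F
  bit (no _)  = 0F

  f : Vec (Fin n) 2 → Vec (Fin 2) n
  f (x ∷ y ∷ []) = word (x ≟ b) (y ≟ a)

  lookup-word-a : ∀ {x y} (d : Dec (x ≡ b)) (e : Dec (y ≡ a)) →
                  lookup (word d e) a ≡ bit e
  lookup-word-a     (yes _) (yes _) = lookup-replicate a 1F
  lookup-word-a     (yes _) (no _)  = lookup-unit-≢ a≢b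
  lookup-word-a     (no _)  (yes _) = lookup∘update a (replicate n 0F) 1F
  lookup-word-a {x} (no _)  (no _)  =
    lookup-unit-≢ (position-≢a x (x ≟ a) ∘ sym)

  lookup-word-b : ∀ {x y} (d : Dec (x ≡ b)) (e : Dec (y ≡ a)) →
                  lookup (word d e) b ≡ bit d
  lookup-word-b     (yes _)  (yes _) = lookup-replicate b 1F
  lookup-word-b     (yes _)  (no _)  = lookup∘update b (replicate n 0F) 1F
  lookup-word-b     (no _)   (yes _) = lookup-unit-≢ (a≢b ∘ sym)
  lookup-word-b {x} (no x≢b) (no _)  =
    lookup-unit-≢ (position-≢b x (x ≟ a) x≢b ∘ sym)

  -- By `lookup-word-a` the bit at `a` only tests whether the second input, the sole member of
  -- `⊤ - 0F`, equals `a`.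
  determines-a : Determines f a (⊤ - 0F)
  determines-a (x ∷ y ∷ []) (x′ ∷ y′ ∷ []) agree =
    trans (lookup-word-a (x ≟ b) (y ≟ a))
      (trans (cong (λ t → bit (t ≟ a)) (agree 1F (there here)))
        (sym (lookup-word-a (x′ ≟ b) (y′ ≟ a))))

  determines-b : Determines f b (⊤ - 1F)
  determines-b (x ∷ y ∷ []) (x′ ∷ y′ ∷ []) agree =
    trans (lookup-word-b (x ≟ b) (y ≟ a))
      (trans (cong (λ t → bit (t ≟ b)) (agree 0F here))
        (sym (lookup-word-b (x′ ≟ b) (y′ ≟ a))))

  -- Vertices sharing the first input cannot include `a`; those sharing the second cannot include
  -- `b`.
  communication : communicationComplex f ⊆ᶜ twoFacets a b
  communication S (inj₁ S-empty)  = inj₁ λ a∈S → S-empty (a , a∈S)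
  communication S (inj₂ (0F , p)) = inj₁ λ a∈S → x∉p-x 0F ⊤
    (proj₂ (inputWindow-smallest f a) _ determines-a (p a a∈S))
  communication S (inj₂ (1F , p)) = inj₂ λ b∈S → x∉p-x 1F ⊤
    (proj₂ (inputWindow-smallest f b) _ determines-b (p b b∈S))

  sound : ∀ x → OneOrAllOnes n (f x)
  sound (x ∷ y ∷ []) = word-sound (x ≟ b) (y ≟ a)
    where
    word-sound : ∀ {x y} (d : Dec (x ≡ b)) (e : Dec (y ≡ a)) →
                 OneOrAllOnes n (word d e)
    word-sound     (yes _) (yes _) = inj₂ (#1s-ones n)
    word-sound     (yes _) (no _)  = inj₁ (#1s-unit b)
    word-sound     (no _)  (yes _) = inj₁ (#1s-unit a)
    word-sound {x} (no _)  (no _)  = inj₁ (#1s-unit (position x (x ≟ a)))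

  f-ones : f (b ∷ a ∷ []) ≡ ones
  f-ones with b ≟ b | a ≟ a
  ... | yes _  | yes _  = refl
  ... | no b≢b | _      = contradiction refl b≢b
  ... | yes _  | no a≢a = contradiction refl a≢a

  f-unit : ∀ m → ∃[ x ] f x ≡ unit m
  f-unit m with m ≟ a
  f-unit m | yes refl = a ∷ a ∷ [] , eq
    where
    eq : f (a ∷ a ∷ []) ≡ unit a
    eq with a ≟ b | a ≟ a
    ... | yes a≡b | _      = contradiction a≡b a≢b
    ... | no _    | yes _  = refl
    ... | no _    | no a≢a = contradiction refl a≢a
  -- The second input `b` differs from `a`, which clears the bit at `a`; the first input then places
  -- the 1 at `m`, even when `m` is `b`.
  f-unit m | no m≢a = m ∷ b ∷ [] , eq
    where
    eq : f (m ∷ b ∷ []) ≡ unit m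
    eq with m ≟ b | b ≟ a
    ... | _        | yes b≡a = contradiction (sym b≡a) a≢b
    ... | yes refl | no _    = refl
    ... | no _     | no _ with m ≟ a
    ...   | yes m≡a = contradiction m≡a m≢a
    ...   | no _    = refl

  complete : ∀ u → OneOrAllOnes n u → ∃[ x ] f x ≡ u
  complete u u∈L with OneOrAllOnes⇒ u u∈L
  ... | inj₁ (m , refl) = f-unit m
  ... | inj₂ refl       = b ∷ a ∷ [] , f-ones

  generates : Generates (twoFacets a b) (OneOrAllOnes n)
  generates = n , 2 , f ,
    (λ u → mk⇔ (complete u) λ { (x , refl) → sound x }) , communication

-- Paths changing one input at a time.

-- Coordinates of `x` are replaced by those of `z` from left to right until `P` first fails. The
-- failing replacement is a genuine change, since otherwise `P` would persist.
boundaryStep : {A : Set} {P : Pred (Vec A j) ℓ} → Decidable P →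
               ∀ x z → P x → ¬ P z →
               ∃[ k ] ∃[ y ] ∃[ v ]
                 (lookup x k ≢ lookup z k × P y × ¬ P (y [ k ]≔ v))
boundaryStep P? []      []      Px ¬Pz = contradiction Px ¬Pz
boundaryStep P? (c ∷ x) (d ∷ z) Px ¬Pz with P? (d ∷ x)
... | no ¬Pdx = zero , c ∷ x , d , (λ { refl → ¬Pdx Px }) , Px , ¬Pdx
... | yes Pdx =
  let k , y , v , x≢z , Py , ¬Py′ = boundaryStep (P? ∘ (d ∷_)) x z Pdx ¬Pz
  in suc k , d ∷ y , v , x≢z , Py , ¬Py′

merge : {A : Set} → Subset j → Vec A j → Vec A j → Vec A j
merge W x y = tabulate λ k → if lookup W k then lookup x k else lookup y k

merge-agree : (W : Subset j) (x y : Vec (Fin b) j) → Agree W x (merge W x y)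
merge-agree W x y k k∈W = sym (trans (lookup∘tabulate _ k)
  (cong (if_then lookup x k else lookup y k) ([]=⇒lookup k∈W)))

-- This confines a path from `y` to the hybrid `merge W x y` to inputs in `W`.
merge-≢ : {A : Set} (W : Subset j) (x y : Vec A j) (k : Fin j) →
          lookup y k ≢ lookup (merge W x y) k → k ∈ W
merge-≢ W x y k y≢ with lookup W k in eq
... | true  = lookup⇒[]= k W eq
... | false = contradiction (sym (trans (lookup∘tabulate _ k)
  (cong (if_then lookup x k else lookup y k) eq))) y≢

-- Were `k` outside the window, the two inputs would agree on it and give the same value at `i`.
inputWindow-changed : ∀ {a} (f : Vec (Fin b) j → Vec (Fin a) n) (i : Fin n) x k v →
                      lookup (f x) i ≢ lookup (f (x [ k ]≔ v)) i →
                      k ∈ inputWindow f i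
inputWindow-changed f i x k v changed =
  decidable-stable (k ∈? inputWindow f i) λ k∉W →
    changed (proj₁ (inputWindow-smallest f i) x (x [ k ]≔ v) λ l l∈W →
      sym (lookup∘update′ (λ { refl → k∉W l∈W }) x v))

-- Two facets forced in the communication complex.

module _ (f : Vec (Fin b) j → Vec (Fin 2) n)
         (image : ∀ u → OneOrAllOnes n u ⇔ (∃[ x ] f x ≡ u)) where

  -- Leaving `ones` inside the language leads to some `unit m`, which differs from `ones` at every
  -- `i ≢ m`. The inequality at `k` is kept to locate `k` later.
  stepFromOnes : ∀ x z → f x ≡ ones → f z ≢ ones →
                 ∃[ k ] ∃[ m ] (lookup x k ≢ lookup z k ×
                   (∀ i → i ≢ m → k ∈ inputWindow f i))
  stepFromOnes x z fx≡1 fz≢1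
    with boundaryStep (λ y → ≡-dec _≟_ (f y) ones) x z fx≡1 fz≢1
  ... | k , y , v , x≢z , fy≡1 , fy′≢1
    with OneOrAllOnes⇒ _ (from (image (f (y [ k ]≔ v))) (_ , refl))
  ...   | inj₂ fy′≡1       = contradiction fy′≡1 fy′≢1
  ...   | inj₁ (m , fy′≡m) = k , m , x≢z , λ i i≢m →
    inputWindow-changed f i y k v (changed i i≢m)
    where
    changed : ∀ i → i ≢ m → lookup (f y) i ≢ lookup (f (y [ k ]≔ v)) i
    changed i i≢m rewrite fy≡1 | fy′≡m | lookup-replicate {A = Fin 2} i 1F
                        | lookup-unit-≢ i≢m = λ ()

  facet : ∀ {k m} → (∀ i → i ≢ m → k ∈ inputWindow f i) →
          Simplex (communicationComplex f) (⊤ - m)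
  facet {k} {m} p = inj₂ (k , λ i i∈ → p i λ { refl → x∉p-x m ⊤ i∈ })

  0-bit⇒≢ones : ∀ {x} i → lookup (f x) i ≡ 0F → f x ≢ ones
  0-bit⇒≢ones i fx≡0 fx≡1
    with trans (sym fx≡0) (trans (cong (λ u → lookup u i) fx≡1) (lookup-replicate i 1F))
  ... | ()

  module _ (other : (i : Fin n) → ∃[ i′ ] i′ ≢ i) where

    0-preimage : ∀ i → ∃[ z ] lookup (f z) i ≡ 0F
    0-preimage i =
      let i′ , i′≢i  = other i
          z , fz≡unit = to (image (unit i′)) (inj₁ (#1s-unit i′))
      in z , trans (cong (λ u → lookup u i) fz≡unit) (lookup-unit-≢ (i′≢i ∘ sym))

    ones-preimage : ∃[ x ] f x ≡ ones
    ones-preimage = to (image ones) (inj₂ (#1s-ones n))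

    facet-exists : Fin n → ∃[ a ] Simplex (communicationComplex f) (⊤ - a)
    facet-exists i =
      let x , fx≡1 = ones-preimage
          z , fz≡0 = 0-preimage i
          _ , a , _ , k∈W = stepFromOnes x z fx≡1 (0-bit⇒≢ones i fz≡0)
      in a , facet k∈W

    facet-≢ : ∀ a → ∃[ b ] (b ≢ a × Simplex (communicationComplex f) (⊤ - b))
    facet-≢ a =
      let x , fx≡1 = ones-preimage
          z , fz≡0 = 0-preimage a
          W        = inputWindow f a
          -- On the window of `a`, `w` copies `z`, so its value at `a` is 0; elsewhere it copies
          -- `x`, so the path from `x` changes only inputs seen by `a`.
          w        = merge W z x
          fz≡fw    = proj₁ (inputWindow-smallest f a) z w (merge-agree W z x)
          fw≡0     = trans (sym fz≡fw) fz≡0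
          k , m , x≢w , k∈W = stepFromOnes x w fx≡1 (0-bit⇒≢ones a fw≡0)
      in choose k m (merge-≢ W z x k x≢w) k∈W
      where
      choose : ∀ k m → k ∈ inputWindow f a → (∀ i → i ≢ m → k ∈ inputWindow f i) →
               ∃[ b ] (b ≢ a × Simplex (communicationComplex f) (⊤ - b))
      choose k m k∈Wa k∈W with m ≟ a
      ... | no m≢a   = m , m≢a , facet k∈W
      -- Here `k` is seen by `a` and by all other vertices, so every set of vertices is a simplex
      -- and any `b ≢ a` will do.
      ... | yes refl =
        let b , b≢a = other a in b , b≢a , inj₂ (k , λ i _ → everywhere i)
        where
        everywhere : ∀ i → k ∈ inputWindow f i
        everywhere i with i ≟ a
        ... | yes refl = k∈Wa
        ... | no i≢a   = k∈W i i≢a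

    twoFacets-necessary : Fin n → ∃[ a ] ∃[ b ] (a ≢ b ×
                            twoFacets a b ⊆ᶜ communicationComplex f)
    twoFacets-necessary i =
      let a , a∈K       = facet-exists i
          b , b≢a , b∈K = facet-≢ a
      in a , b , b≢a ∘ sym , twoFacets-⊆ᶜ (communicationComplex f) a∈K b∈K

-- Minimal generating complexes.

Generates-mono : ∀ {a} {K K′ : Complex n} {L : Pred (Vec (Fin a) n) _} →
                 K ⊆ᶜ K′ → Generates K L → Generates K′ L
Generates-mono K⊆K′ (b , j , f , image , Kf⊆K) =
  b , j , f , image , λ S → K⊆K′ S ∘ Kf⊆K S

generates⇒⊇twoFacets : {K : Complex (suc (suc n))} →
                       Generates K (OneOrAllOnes (suc (suc n))) →
                       ∃[ a ] ∃[ b ] (a ≢ b × twoFacets a b ⊆ᶜ K)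
generates⇒⊇twoFacets (_ , _ , f , image , Kf⊆K) =
  let a , b , a≢b , ⊆Kf = twoFacets-necessary f image
        -- The last `0F` is an arbitrary vertex at which the first path ends with value 0.
        (λ i → punchIn i 0F , punchInᵢ≢i i 0F) 0F
  in a , b , a≢b , λ S → Kf⊆K S ∘ ⊆Kf S

proposition3p4 : (n : ℕ) → 3 ≤ n → (K : Complex n) →
    IsMinimalGenerating K (OneOrAllOnes n) ⇔
    (∃[ a ] ∃[ b ] (a ≢ b ×
    (∀ (S : Subset n) → IsMaximalSimplex K S ⇔ (S ≡ ⊤ - a ⊎ S ≡ ⊤ - b))))
proposition3p4 n@(suc (suc (suc _))) (s≤s (s≤s (s≤s _))) K =
  mk⇔ minimal⇒facets facets⇒minimal
  where
  L = OneOrAllOnes n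

  twoFacets-generates : ∀ {a b} → a ≢ b → Generates (twoFacets a b) L
  twoFacets-generates a≢b =
    let _ , c≢a , c≢b = third _ _ a≢b in TwoInputs.generates a≢b c≢a c≢b

  minimal⇒facets : IsMinimalGenerating K L →
                   ∃[ a ] ∃[ b ] (a ≢ b × HasFacets K a b)
  minimal⇒facets (K-gen , K-min) =
    let a , b , a≢b , ⊆K = generates⇒⊇twoFacets {K = K} K-gen
        -- A simplex of `K` outside `twoFacets a b` would make the latter a strictly smaller
        -- generating complex.
        K⊆ S S∈K = decidable-stable (simplex? (twoFacets a b) S) λ S∉ →
          K-min (twoFacets a b) (⊆K , λ K⊆ → S∉ (K⊆ S S∈K)) (twoFacets-generates a≢b)
    in a , b , a≢b , twoFacets⇒facets K a≢b K⊆ ⊆K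

  facets⇒minimal : ∃[ a ] ∃[ b ] (a ≢ b × HasFacets K a b) →
                   IsMinimalGenerating K L
  facets⇒minimal (a , b , a≢b , facets) =
    Generates-mono {K = twoFacets a b} {K} ⊆K (twoFacets-generates a≢b) , minimal
    where
    K⊆ = proj₁ (facets⇒twoFacets K facets)
    ⊆K = proj₂ (facets⇒twoFacets K facets)

    minimal : ∀ K′ → K′ ⊂ᶜ K → ¬ Generates K′ L
    minimal K′ (K′⊆K , K⊈K′) K′-gen =
      -- The two facets found in `K′` are also simplices of `K`, hence are its own two facets, and
      -- `K′` contains all of `K`.
      let c , d , c≢d , ⊆K′ = generates⇒⊇twoFacets {K = K′} K′-gen
          ab⊆cd = twoFacets-unique c≢d λ S → K⊆ S ∘ K′⊆K S ∘ ⊆K′ S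
      in K⊈K′ λ S → ⊆K′ S ∘ ab⊆cd S ∘ K⊆ S
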